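{- If $G$ is a graph with no isolated vertices, then $\gamma_{\rm gr}^t(G)\le 2\gamma_{\rm gr}(G)$.
   Context: $N(v)$ denotes the open neighborhood and $N[v]=N(v)\cup\{v\}$ the closed neighborhood of $v$. A sequence $S=(v_1,\ldots,v_k)$ of distinct vertices is a legal open neighborhood sequence if $N(v_i)\setminus \bigcup_{j=1}^{i-1} N(v_j)\neq\emptyset$ for every $i\in\{2,\ldots,k\}$, and a total dominating sequence if moreover $\{v_1,\ldots,v_k\}$ is a total dominating set (every vertex has a neighbor in it); $\gamma_{\rm gr}^t(G)$ is the maximum length of a total dominating sequence. A sequence $S=(v_1,\ldots,v_k)$ of distinct vertices is a legal closed neighborhood sequence if $N[v_i]\setminus \bigcup_{j=1}^{i-1} N[v_j]\neq\emptyset$ for every $i\in\{2,\ldots,k\}$, and a dominating sequence if moreover $\{v_1,\ldots,v_k\}$ is a dominating set (every vertex is in it or has a neighbor in it); the Grundy domination number $\gamma_{\rm gr}(G)$ is the maximum length of a dominating sequence. -}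

module Defs where

open import Data.Fin using (Fin; toℕ) renaming (_<_ to _<ᶠ_; _<?_ to _<ᶠ?_)
open import Data.Fin.Properties using (any?; all?; injective⇒≤) renaming (_≟_ to _≟ᶠ_)
open import Data.List using (filter; upTo)
open import Data.List.Extrema.Nat using (max; xs≤max; argmax-sel)
open import Data.List.Membership.Propositional.Properties using (∈-filter⁺; ∈-filter⁻; ∈-upTo⁺)
import Data.List.Relation.Unary.All as All
open import Data.Nat using (ℕ; zero; suc; _≤_; _≤?_; s≤s)
open import Data.Nat.Properties using (n≤0⇒n≡0)
open import Data.Product using (∃; _×_; _,_; proj₁; proj₂)
open import Data.Sum using (_⊎_; inj₁; inj₂)
open import Data.Vec using (Vec; []; _∷_; lookup)
open import Data.Vec.Membership.Propositional using () renaming (_∈_ to _∈ᵛ_)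
import Data.Vec.Membership.DecPropositional as DecMembership
open import Data.Vec.Relation.Unary.AllPairs using (allPairs?)
open import Data.Vec.Relation.Unary.Unique.Propositional using (Unique)
open import Data.Vec.Relation.Unary.Unique.Propositional.Properties using (lookup-injective)
open import Function using (id)
open import Level using (0ℓ)
open import Relation.Binary using (Rel; Symmetric; Irreflexive) renaming (Decidable to Decidable₂)
open import Relation.Binary.PropositionalEquality using (_≡_; sym; subst)
open import Relation.Nullary using (Dec; ¬?)
open import Relation.Nullary.Decidable using (map′; _×-dec_; _⊎-dec_; _→-dec_)
open import Relation.Unary using (Pred; Decidable; Satisfiable; _∈_; _∪_; _∖_; ⋃; ｛_｝)

-- Finite simple graphs.  Adjacency is decidable, as it is classically; this is
-- what makes the maxima below computable.
record Graph (n : ℕ) : Set₁ where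
  field
    Adj    : Rel (Fin n) 0ℓ
    adj?   : Decidable₂ Adj
    symm   : Symmetric Adj
    irrefl : Irreflexive _≡_ Adj

open Graph public

module _ {n : ℕ} (G : Graph n) where

  N : Fin n → Pred (Fin n) 0ℓ
  N v u = Adj G v u

  N[_] : Fin n → Pred (Fin n) 0ℓ
  N[ v ] = N v ∪ ｛ v ｝

  NoIsolatedVertices : Set
  NoIsolatedVertices = ∀ v → Satisfiable (N v)

  TotalDominating : Pred (Fin n) 0ℓ → Set
  TotalDominating D = ∀ u → ∃ λ w → w ∈ D × w ∈ N u

  Dominating : Pred (Fin n) 0ℓ → Set
  Dominating D = ∀ u → u ∈ D ⊎ ∃ λ w → w ∈ D × w ∈ N u

  N? : ∀ v → Decidable (N v)
  N? v u = adj? G v u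

  N[_]? : ∀ v → Decidable N[ v ]
  N[ v ]? u = N? v u ⊎-dec (v ≟ᶠ u)

-- Positions are counted from 0, so the indices 2, …, k of (v₁,…,vₖ) are the
-- positions i with 1 ≤ toℕ i.
Legal : ∀ {n k} → (Fin n → Pred (Fin n) 0ℓ) → Vec (Fin n) k → Set
Legal {k = k} M S = ∀ (i : Fin k) → 1 ≤ toℕ i →
  Satisfiable (M (lookup S i) ∖ ⋃ (∃ λ j → j <ᶠ i) (λ p → M (lookup S (proj₁ p))))

module _ {n : ℕ} (G : Graph n) where

  LegalOpen : ∀ {k} → Vec (Fin n) k → Set
  LegalOpen S = Unique S × Legal (N G) S

  LegalClosed : ∀ {k} → Vec (Fin n) k → Set
  LegalClosed S = Unique S × Legal (N[_] G) S

  TotalDominatingSequence : ∀ {k} → Vec (Fin n) k → Set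
  TotalDominatingSequence S = LegalOpen S × TotalDominating G (_∈ᵛ S)

  DominatingSequence : ∀ {k} → Vec (Fin n) k → Set
  DominatingSequence S = LegalClosed S × Dominating G (_∈ᵛ S)

legal? : ∀ {n k} {M : Fin n → Pred (Fin n) 0ℓ} → (∀ v → Decidable (M v)) →
         (S : Vec (Fin n) k) → Dec (Legal M S)
legal? M? S = all? λ i → (1 ≤? toℕ i) →-dec
  any? λ u → M? (lookup S i) u ×-dec
    ¬? (map′ (λ (j , j<i , m) → (j , j<i) , m) (λ ((j , j<i) , m) → j , j<i , m)
      (any? λ j → (j <ᶠ? i) ×-dec M? (lookup S j) u))

unique? : ∀ {n k} (S : Vec (Fin n) k) → Dec (Unique S)
unique? = allPairs? λ x y → ¬? (x ≟ᶠ y)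

module _ {n : ℕ} (G : Graph n) where

  open DecMembership (_≟ᶠ_ {n}) using (_∈?_)

  totalDominatingSequence? : ∀ {k} (S : Vec (Fin n) k) → Dec (TotalDominatingSequence G S)
  totalDominatingSequence? S =
    (unique? S ×-dec legal? (N? G) S) ×-dec
    all? λ u → any? λ w → (w ∈? S) ×-dec N? G u w

  dominatingSequence? : ∀ {k} (S : Vec (Fin n) k) → Dec (DominatingSequence G S)
  dominatingSequence? S =
    (unique? S ×-dec legal? (N[_]? G) S) ×-dec
    all? λ u → (u ∈? S) ⊎-dec any? λ w → (w ∈? S) ×-dec N? G u w

anyVec? : ∀ {n k} {P : Pred (Vec (Fin n) k) 0ℓ} → Decidable P → Dec (∃ P)
anyVec? {k = zero}  P? = map′ ([] ,_) (λ { ([] , p) → p }) (P? [])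
anyVec? {k = suc k} P? =
  map′ (λ (x , xs , p) → x ∷ xs , p) (λ { (x ∷ xs , p) → x , xs , p })
    (any? λ x → anyVec? λ xs → P? (x ∷ xs))

-- The largest k ≤ n satisfying P, and 0 if there is none.
greatest : ∀ {P : Pred ℕ 0ℓ} → Decidable P → ℕ → ℕ
greatest P? n = max 0 (filter P? (upTo (suc n)))

IsMaximum : Pred ℕ 0ℓ → ℕ → Set
IsMaximum P m = P m × ∀ k → P k → k ≤ m

greatest-isMaximum : ∀ {P : Pred ℕ 0ℓ} (P? : Decidable P) n →
  (∀ k → P k → k ≤ n) → ∃ P → IsMaximum P (greatest P? n)
greatest-isMaximum {P} P? n bound (k₀ , p₀) = attained , upper
  where
  upper : ∀ k → P k → k ≤ greatest P? n
  upper k p = All.lookup (xs≤max 0 _) (∈-filter⁺ P? (∈-upTo⁺ (s≤s (bound k p))) p)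

  attained : P (greatest P? n)
  attained with argmax-sel id 0 (filter P? (upTo (suc n)))
  ... | inj₂ m∈ = proj₂ (∈-filter⁻ P? {xs = upTo (suc n)} m∈)
  ... | inj₁ m≡0 = subst P (sym m≡0) (subst P (n≤0⇒n≡0 (subst (k₀ ≤_) m≡0 (upper k₀ p₀))) p₀)

unique⇒≤ : ∀ {n k} {S : Vec (Fin n) k} → Unique S → k ≤ n
unique⇒≤ u = injective⇒≤ (lookup-injective u _ _)

module _ {n : ℕ} (G : Graph n) where

  TotalDominatingLength : Pred ℕ 0ℓ
  TotalDominatingLength k = ∃ λ (S : Vec (Fin n) k) → TotalDominatingSequence G S

  DominatingLength : Pred ℕ 0ℓ
  DominatingLength k = ∃ λ (S : Vec (Fin n) k) → DominatingSequence G S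

  totalDominatingLength? : Decidable TotalDominatingLength
  totalDominatingLength? k = anyVec? {k = k} (totalDominatingSequence? G)

  dominatingLength? : Decidable DominatingLength
  dominatingLength? k = anyVec? {k = k} (dominatingSequence? G)

  -- A sequence of distinct vertices has length at most n, so searching up to n
  -- gives the true maximum (see the two lemmas below).  The value is the
  -- default 0 only if no such sequence exists, which happens for γgrᵗ exactly
  -- when G has an isolated vertex, and never for γgr.
  γgrᵗ : ℕ
  γgrᵗ = greatest totalDominatingLength? n

  γgr : ℕ
  γgr = greatest dominatingLength? n

  γgrᵗ-isMaximum : ∃ TotalDominatingLength → IsMaximum TotalDominatingLength γgrᵗ
  γgrᵗ-isMaximum = greatest-isMaximum totalDominatingLength? n λ { _ (_ , (u , _) , _) → unique⇒≤ u }

  γgr-isMaximum : ∃ DominatingLength → IsMaximum DominatingLength γgr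
  γgr-isMaximum = greatest-isMaximum dominatingLength? n λ { _ (_ , (u , _) , _) → unique⇒≤ u }

{-# OPTIONS --safe #-}

-- Let u₁, …, uₖ be footprints of an open neighborhood sequence (v₁, …, vₖ), so
-- that uᵢ ∈ N(vᵢ) and uⱼ ∉ N(vᵢ) for i < j.  The only obstruction to uⱼ ∉ N[vᵢ]
-- is uⱼ = vᵢ.  As the uⱼ are distinct, each vᵢ is obstructed by at most one
-- later term, so going from right to left the sequence splits greedily into two
-- closed neighborhood sequences, one of which has length at least k/2.  A closed
-- neighborhood sequence extends to a dominating one by appending undominated
-- vertices.
module Submission where

open import Defs
open import Data.Fin using (Fin; zero; suc) renaming (_<_ to _<ᶠ_)
open import Data.Fin.Properties using () renaming (_≟_ to _≟ᶠ_; <-cmp to <ᶠ-cmp)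
open import Data.List using (List; []; _∷_; _∷ʳ_; length; lookup; map; allFin; tabulate; upTo)
open import Data.List.Extrema.Nat using (max≤v⁺)
open import Data.List.Membership.Propositional using (_∉_)
open import Data.List.Membership.Propositional.Properties using (∈-allFin; ∈-filter⁻; ∈-lookup)
import Data.List.Membership.DecPropositional as DecMembership
open import Data.List.Properties using (length-tabulate; length-++-≤ˡ)
open import Data.List.Relation.Binary.Disjoint.Propositional using (Disjoint)
open import Data.List.Relation.Binary.Subset.Propositional using (_⊆_)
open import Data.List.Relation.Binary.Subset.Propositional.Properties
  using (∷⁺ʳ; xs⊆x∷xs; xs⊆xs++ys; ⊆-trans; Any-resp-⊆)
open import Data.List.Relation.Unary.All as All using (All; []; _∷_)
import Data.List.Relation.Unary.All.Properties as All
open import Data.List.Relation.Unary.AllPairs using (AllPairs; []; _∷_)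
import Data.List.Relation.Unary.AllPairs.Properties as AllPairs
open import Data.List.Relation.Unary.Any as Any using (Any; here; there)
open import Data.List.Relation.Unary.Any.Properties using (++⁺ʳ; lookup-index)
open import Data.Nat using (ℕ; suc; _≤_; _+_; _*_; z≤n; s≤s; s<s)
open import Data.Nat.Properties using (≤-refl; ≤-trans; +-mono-≤; m≤m+n; +-suc; module ≤-Reasoning)
open import Data.Product using (∃; _×_; _,_; proj₁; proj₂)
open import Data.Sum using (inj₁; inj₂; [_,_])
open import Data.Vec as Vec using (Vec)
open import Data.Vec.Membership.Propositional using () renaming (_∈_ to _∈ᵛ_)
open import Data.Vec.Membership.Propositional.Properties using (∈-tabulate⁺)
open import Data.Vec.Properties using (lookup∘tabulate)
import Data.Vec.Relation.Unary.Unique.Propositional.Properties as Unique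
open import Function using (_∘_)
open import Level using (Level; 0ℓ)
open import Relation.Binary using (Rel; tri<; tri≈; tri>)
open import Relation.Binary.PropositionalEquality using (_≡_; refl; sym; trans; cong; subst)
open import Relation.Nullary using (¬_; yes; no; contradiction)
open import Relation.Unary using (Pred; Decidable)

private
  variable
    a ℓ : Level
    A : Set a
    n : ℕ

AllPairs-lookup : {R : Rel A ℓ} {xs : List A} → AllPairs R xs →
                  ∀ {i j} → i <ᶠ j → R (lookup xs i) (lookup xs j)
AllPairs-lookup (px ∷ _)  {zero}  {suc j} _         = All.lookup px (∈-lookup j)
AllPairs-lookup (_ ∷ pxs) {suc i} {suc j} (s<s i<j) = AllPairs-lookup pxs i<j

-- The default `0` lies below every `m`, so bounding the values that satisfy `P` suffices, whether
-- or not there are any.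
greatest-≤ : ∀ {P : Pred ℕ 0ℓ} (P? : Decidable P) n {m} →
             (∀ k → P k → k ≤ m) → greatest P? n ≤ m
greatest-≤ P? n bound = max≤v⁺ z≤n (All.tabulate λ {k} k∈ →
  bound k (proj₂ (∈-filter⁻ P? {xs = upTo (suc n)} k∈)))

-- A sequence of vertices v is encoded as a list of pairs (v , u), where u is a
-- vertex of M v that lies in no M w with w earlier than v.
record Footprinted (M : Fin n → Pred (Fin n) 0ℓ) (xs : List (Fin n × Fin n)) : Set where
  constructor _,_
  field
    footprints : All (λ (v , u) → M v u) xs
    fresh      : AllPairs (λ (v , _) (_ , u) → ¬ M v u) xs

open Footprinted

vertices : (xs : List (Fin n × Fin n)) → Vec (Fin n) (length xs)
vertices xs = Vec.tabulate (proj₁ ∘ lookup xs)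

module _ {M : Fin n → Pred (Fin n) 0ℓ} {xs : List (Fin n × Fin n)} (f : Footprinted M xs) where

  Footprinted⇒Legal : Legal M (vertices xs)
  Footprinted⇒Legal i _ =
    proj₂ (lookup xs i) ,
    subst (λ v → M v (proj₂ (lookup xs i))) (sym (lookup∘tabulate _ i)) (All.lookup (footprints f) (∈-lookup i)) ,
    λ ((j , j<i) , m) →
      AllPairs-lookup (fresh f) j<i (subst (λ v → M v (proj₂ (lookup xs i))) (lookup∘tabulate _ j) m)

  -- If a vertex occurred twice, the footprint of the later occurrence would lie in `M` of the
  -- earlier one, against freshness. Distinctness thus comes with the footprints.
  Footprinted⇒lookup-injective : ∀ {i j} → proj₁ (lookup xs i) ≡ proj₁ (lookup xs j) → i ≡ j
  Footprinted⇒lookup-injective {i} {j} eq with <ᶠ-cmp i j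
  ... | tri≈ _ i≡j _ = i≡j
  ... | tri< i<j _ _ = contradiction
    (subst (λ v → M v _) (sym eq) (All.lookup (footprints f) (∈-lookup j)))
    (AllPairs-lookup (fresh f) i<j)
  ... | tri> _ _ j<i = contradiction
    (subst (λ v → M v _) eq (All.lookup (footprints f) (∈-lookup i)))
    (AllPairs-lookup (fresh f) j<i)

module _ (G : Graph n) where

  open DecMembership (_≟ᶠ_ {n}) using (_∈?_)

  Dominated : List (Fin n × Fin n) → Pred (Fin n) 0ℓ
  Dominated xs w = Any (λ (v , _) → N[_] G v w) xs

  dominated? : ∀ xs → Decidable (Dominated xs)
  dominated? xs w = Any.any? (λ (v , _) → N[_]? G v w) xs

  -- One pass over `ws` suffices: pairs are only ever added, so a vertex once dominated stays
  -- dominated.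
  extend : ∀ ws {xs} → Footprinted (N[_] G) xs → ∃ λ ys →
           Footprinted (N[_] G) ys × xs ⊆ ys × length xs ≤ length ys × All (Dominated ys) ws
  extend []       {xs} f = xs , f , (λ x∈ → x∈) , ≤-refl , []
  extend (w ∷ ws) {xs} f with dominated? xs w
  ... | yes d =
    let ys , g , xs⊆ys , len , ds = extend ws f
    in  ys , g , xs⊆ys , len , Any-resp-⊆ xs⊆ys d ∷ ds
  ... | no ¬d =
    -- An undominated `w` lies in no earlier closed neighborhood but does lie in its own, so it can
    -- serve as its own footprint.
    let ys , g , xs+w⊆ys , len , ds = extend ws {xs ∷ʳ (w , w)}
          ( All.∷ʳ⁺ (footprints f) (inj₂ refl)
          , AllPairs.++⁺ (fresh f) ([] ∷ []) (All.map (_∷ []) (All.¬Any⇒All¬ xs ¬d)))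
    in  ys , g , ⊆-trans (xs⊆xs++ys xs _) xs+w⊆ys , ≤-trans (length-++-≤ˡ xs) len ,
        Any-resp-⊆ xs+w⊆ys (++⁺ʳ xs (here (inj₂ refl))) ∷ ds

  dominatingSequence : ∀ {xs} → Footprinted (N[_] G) xs → (∀ w → Dominated xs w) →
                       DominatingSequence G (vertices xs)
  dominatingSequence {xs} f d =
    (Unique.tabulate⁺ (Footprinted⇒lookup-injective f) , Footprinted⇒Legal f) , dominating
    where
    dominating : Dominating G (_∈ᵛ vertices xs)
    dominating w with Any.index (d w) | lookup-index (d w)
    ... | i | inj₁ adj  = inj₂ (_ , ∈-tabulate⁺ _ i , symm G adj)
    ... | i | inj₂ refl = inj₁ (∈-tabulate⁺ _ i)

  length≤γgr : ∀ {xs} → Footprinted (N[_] G) xs → length xs ≤ γgr G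
  length≤γgr f =
    let ys , g , _ , len , ds = extend (allFin n) f
        S = vertices ys , dominatingSequence g (λ w → All.lookup ds (∈-allFin w))
    in  ≤-trans len (proj₂ (γgr-isMaximum G (_ , S)) _ S)

  -- The inclusions carry the freshness of a new head over to both halves. Disjointness concerns the
  -- footprints, so that a vertex can be a footprint in at most one half.
  record Splitting (xs : List (Fin n × Fin n)) : Set where
    field
      {left right} : List (Fin n × Fin n)
      leftClosed   : Footprinted (N[_] G) left
      rightClosed  : Footprinted (N[_] G) right
      left⊆        : left ⊆ xs
      right⊆       : right ⊆ xs
      disjoint     : Disjoint (map proj₂ left) (map proj₂ right)
      lengths      : length xs ≡ length left + length right

  -- Since `N[_] G v` exceeds `N G v` only by `v`, passing from open to closed freshness can fail
  -- only if `v` is itself a later footprint.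
  closed-∷ : ∀ {v u ys} → N G v u → All (λ (_ , w) → ¬ N G v w) ys → v ∉ map proj₂ ys →
         Footprinted (N[_] G) ys → Footprinted (N[_] G) ((v , u) ∷ ys)
  closed-∷ {v} {ys = ys} vu ¬vys v∉ (fs , frs) = inj₁ vu ∷ fs , closedFresh ∷ frs
    where
    closedFresh : All (λ (_ , w) → ¬ N[_] G v w) ys
    closedFresh = All.map⁻ {P = λ w → ¬ N[_] G v w} (All.tabulate λ w∈ →
      [ All.lookup (All.map⁺ {P = λ w → ¬ N G v w} ¬vys) w∈ , (λ { refl → v∉ w∈ }) ])

  split : ∀ {xs} → Footprinted (N G) xs → Splitting xs
  split ([] , []) = record
    { leftClosed = [] , [] ; rightClosed = [] , [] ; left⊆ = λ () ; right⊆ = λ ()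
    ; disjoint = λ () ; lengths = refl }
  split {(v , u) ∷ xs} (vu ∷ fs , ¬vxs ∷ frs) = go (v ∈? map proj₂ left)
    where
    open Splitting (split (fs , frs))

    ¬vleft  = All.anti-mono left⊆ ¬vxs
    ¬vright = All.anti-mono right⊆ ¬vxs

    go : _ → Splitting ((v , u) ∷ xs)
    go (no v∉left) = record
      { leftClosed  = closed-∷ vu ¬vleft v∉left leftClosed
      ; rightClosed = rightClosed
      ; left⊆       = ∷⁺ʳ _ left⊆
      ; right⊆      = ⊆-trans right⊆ (xs⊆x∷xs xs _)
      -- No footprint in `right` is adjacent to `v`, whereas `u` is, so `u` is new to `right`.
      ; disjoint    = λ { (here refl , q) → All.lookup (All.map⁺ ¬vright) q vu
                        ; (there p , q)   → disjoint (p , q) }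
      ; lengths     = cong suc lengths
      }
    go (yes v∈left) = record
      { leftClosed  = leftClosed
      -- As `v` is already a footprint in `left`, disjointness keeps it from being one in `right`.
      ; rightClosed = closed-∷ vu ¬vright (λ v∈right → disjoint (v∈left , v∈right)) rightClosed
      ; left⊆       = ⊆-trans left⊆ (xs⊆x∷xs xs _)
      ; right⊆      = ∷⁺ʳ _ right⊆
      ; disjoint    = λ { (p , here refl) → All.lookup (All.map⁺ ¬vleft) p vu
                        ; (p , there q)   → disjoint (p , q) }
      ; lengths     = trans (cong suc lengths) (sym (+-suc _ _))
      }

  -- Legality says nothing about position 0, so its footprint comes from the
  -- absence of isolated vertices.
  footprint : NoIsolatedVertices G → ∀ {k} (S : Vec (Fin n) k) → Legal (N G) S → ∀ i →
              ∃ λ u → N G (Vec.lookup S i) u × (∀ {j} → j <ᶠ i → ¬ N G (Vec.lookup S j) u)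
  footprint nonIsolated S legal zero =
    let u , adj = nonIsolated (Vec.lookup S zero) in u , adj , λ ()
  footprint nonIsolated S legal i@(suc _) =
    let u , adj , ¬earlier = legal i (s≤s z≤n) in u , adj , λ j<i m → ¬earlier ((_ , j<i) , m)

  legalOpen-length≤ : NoIsolatedVertices G → ∀ {k} (S : Vec (Fin n) k) → Legal (N G) S →
                      k ≤ 2 * γgr G
  legalOpen-length≤ nonIsolated {k} S legal = begin
    k                          ≡⟨ length-tabulate pair ⟨
    length (tabulate pair)     ≡⟨ lengths ⟩
    length left + length right ≤⟨ +-mono-≤ (length≤γgr leftClosed)
                                           -- `2 * γgr G` unfolds to `γgr G + (γgr G + 0)`, whence
                                           -- the extra `0`.
                                           (≤-trans (length≤γgr rightClosed) (m≤m+n _ 0)) ⟩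
    2 * γgr G                  ∎
    where
    open ≤-Reasoning

    fp = footprint nonIsolated S legal

    pair : Fin k → Fin n × Fin n
    pair i = Vec.lookup S i , proj₁ (fp i)

    open Splitting (split {tabulate pair}
      ( All.tabulate⁺ {f = pair} (λ i → proj₁ (proj₂ (fp i)))
      , AllPairs.tabulate⁺-< {f = pair} (λ {_} {j} i<j → proj₂ (proj₂ (fp j)) i<j)))

mainTheorem16 : ∀ {n : ℕ} (G : Graph n) → NoIsolatedVertices G → γgrᵗ G ≤ 2 * γgr G
mainTheorem16 {n} G nonIsolated = greatest-≤ (totalDominatingLength? G) n
  λ { _ (S , (_ , legal) , _) → legalOpen-length≤ G nonIsolated S legal }
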